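{- Let $n\ge 1$ and let $A=(a_{ij})_{1\le i,j\le n}$ be the general $n\times n$ matrix, whose entries $a_{ij}$ are $n^2$ independent commuting indeterminates. Let $S\subseteq\{(i,j)\mid 1\le i,j\le n\}$ be any subset of cardinality $n+1$. Then there exist polynomials $q_s\in\mathbb{Q}[a_{ij}: 1\le i,j\le n]$, $s\in S$, not all zero and independent of $m$, such that $$\sum_{s\in S} q_s\cdot (A^m)_s=0$$ for all integers $m>1$.
   Context: For a matrix $B$ and a position $s=(i,j)$, $B_s=B_{ij}$ denotes the $(i,j)$ entry of $B$. The polynomials $q_s$ may depend on $n$ and $S$ but not on the exponent $m$. -}

module Defs where

open import Algebra.Bundles.Raw using (RawRing)
import Algebra.Definitions.RawMonoid as RawMonoidDefs
open import Data.Bool.Base using (if_then_else_)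
open import Data.Fin.Base using (Fin; zero; suc; combine; remQuot)
open import Data.Fin.Properties using (_≟_)
open import Data.Fin.Subset using (Subset)
open import Data.Fin.Subset.Properties using (_∈?_)
open import Data.List.Base using (List; []; _∷_; map)
open import Data.Nat.Base as ℕ using (ℕ; zero; suc)
open import Data.Product.Base using (uncurry)
open import Data.Rational.Base using (+-*-rawRing)
open import Level using (0ℓ)
open import Relation.Nullary.Decidable.Core using (does)

module Univariate {c ℓ} (R : RawRing c ℓ) where
  open RawRing R

  -- Coefficients in order of increasing degree; trailing zeros are allowed and
  -- are identified by _≈ₚ_.
  Poly : Set c
  Poly = List Carrier

  coeff : Poly → ℕ → Carrier
  coeff []      _       = 0#
  coeff (a ∷ p) zero    = a
  coeff (a ∷ p) (suc i) = coeff p i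

  _≈ₚ_ : Poly → Poly → Set ℓ
  p ≈ₚ q = ∀ i → coeff p i ≈ coeff q i

  _+ₚ_ : Poly → Poly → Poly
  []      +ₚ q       = q
  (a ∷ p) +ₚ []      = a ∷ p
  (a ∷ p) +ₚ (b ∷ q) = (a + b) ∷ (p +ₚ q)

  -- (a + X p) q = a q + X (p q)
  _*ₚ_ : Poly → Poly → Poly
  []      *ₚ q = []
  (a ∷ p) *ₚ q = map (a *_) q +ₚ (0# ∷ (p *ₚ q))

  const : Carrier → Poly
  const a = a ∷ []

  X : Poly
  X = 0# ∷ 1# ∷ []

  polyRawRing : RawRing c ℓ
  polyRawRing = record
    { Carrier = Poly
    ; _≈_     = _≈ₚ_
    ; _+_     = _+ₚ_
    ; _*_     = _*ₚ_
    ; -_      = map (-_)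
    ; 0#      = []
    ; 1#      = const 1#
    }

-- ℚ[x₀, …, xₖ₋₁], built by adjoining one indeterminate at a time; in
-- ℚ[ suc k ] the indeterminate x₀ is the one adjoined last.
ℚ[_] : ℕ → RawRing 0ℓ 0ℓ
ℚ[ zero ]  = +-*-rawRing
ℚ[ suc k ] = Univariate.polyRawRing ℚ[ k ]

var : ∀ {k} → Fin k → RawRing.Carrier ℚ[ k ]
var {suc k} zero    = Univariate.X ℚ[ k ]
var {suc k} (suc i) = Univariate.const ℚ[ k ] (var i)

-- The n² positions (i , j) are encoded as Fin (n ℕ.* n) through the library
-- bijection combine / remQuot, so that Data.Fin.Subset applies to them.
Position : ℕ → Set
Position n = Fin (n ℕ.* n)

module _ {c ℓ} (R : RawRing c ℓ) where
  open RawRing R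
  open RawMonoidDefs +-rawMonoid using (sum)

  Matrix : ℕ → Set c
  Matrix n = Fin n → Fin n → Carrier

  identity : ∀ {n} → Matrix n
  identity i j = if does (i ≟ j) then 1# else 0#

  mul : ∀ {n} → Matrix n → Matrix n → Matrix n
  mul B C i j = sum (λ k → B i k * C k j)

  power : ∀ {n} → Matrix n → ℕ → Matrix n
  power B zero    = identity
  power B (suc m) = mul B (power B m)

  entry : ∀ {n} → Matrix n → Position n → Carrier
  entry {n} B s = uncurry B (remQuot n s)

  sumOver : ∀ {k} → Subset k → (Fin k → Carrier) → Carrier
  sumOver S f = sum (λ s → if does (s ∈? S) then f s else 0#)

generalMatrix : ∀ n → Matrix ℚ[ n ℕ.* n ] n
generalMatrix n i j = var (combine i j)

{-# OPTIONS --safe #-}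

-- By Cayley–Hamilton the entry sequences m ↦ (Aᵐ)ᵢⱼ all satisfy the recurrence given by
-- the characteristic polynomial, which is monic of degree n. Hence a combination
-- Σ qₛ (Aᵐ)ₛ vanishes for all m ≥ 2 as soon as it vanishes for 2 ≤ m ≤ n + 1, and these
-- are n linear equations in n + 1 unknowns over an integral domain.
--
-- Cayley–Hamilton is obtained by the determinant trick in the R[X]-module of sequences in
-- R, where X acts as the shift: the entries of a column of Aᵐ satisfy the n linear
-- relations with matrix XI - A, so det (XI - A) annihilates them. Determinants are top
-- coefficients of exterior products of rows.
module Submission where

open import Algebra.Bundles using (CommutativeMonoid; CommutativeRing)
open import Algebra.Bundles.Raw using (RawRing)
open import Algebra.Module.Bundles using (LeftModule)
import Algebra.Module.Construct.DirectProduct as DirectProduct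
import Algebra.Module.Construct.TensorUnit as TensorUnit
import Algebra.Properties.AbelianGroup as AbelianGroupProperties
import Algebra.Properties.CommutativeMonoid.Sum as CommutativeMonoidSum
import Algebra.Properties.CommutativeSemigroup as CommutativeSemigroupProperties
import Algebra.Properties.Ring as RingProperties
import Algebra.Properties.Semiring.Sum as SemiringSum
open import Algebra.Structures using (IsCommutativeRing)
open import Data.Bool.Base using (true; false; if_then_else_)
open import Data.Fin.Base using (Fin; zero; suc; toℕ; fromℕ<; punchIn; punchOut; remQuot)
open import Data.Fin.Properties as Fin using (all?; ¬∀⟶∃¬; punchIn-punchOut; toℕ-fromℕ<)
open import Data.Fin.Subset using (Subset; inside; outside; _∈_; ∣_∣)
open import Data.Fin.Subset.Properties using (_∈?_)
open import Data.List.Base using ([]; _∷_; map)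
open import Data.Nat.Base as ℕ using (ℕ; zero; suc; _≥_; _>_; _<_; s≤s; z≤n)
import Data.Nat.Properties as ℕ
open import Data.Product.Base using (Σ; ∃; _×_; _,_; proj₁; proj₂)
open import Data.Rational.Base as ℚ using (ℚ; 0ℚ)
import Data.Rational.Properties as ℚ
open import Data.Sum.Base using (_⊎_; inj₁; inj₂)
open import Data.Vec.Base using ([]; _∷_; here; there)
open import Function.Base using (_∘_)
open import Level using (_⊔_)
import Relation.Binary.Reasoning.Setoid as SetoidReasoning
open import Relation.Binary.PropositionalEquality.Core as ≡ using (_≡_)
open import Relation.Binary.PropositionalEquality.Properties using (module ≡-Reasoning)
open import Relation.Binary.Structures using (IsEquivalence)
open import Relation.Nullary.Decidable.Core using (Dec; yes; no; does)
open import Relation.Nullary.Negation.Core using (¬_; contradiction)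
open import Defs

-- Polynomials over a commutative ring

-- Sequences keep the determinant trick inside commutative algebra: no polynomial is ever evaluated
-- at a matrix, and the rule Aᵐ⁺¹ = A Aᵐ itself supplies the relations. Of determinants, the proof
-- uses that a repeated row kills an exterior product, that moving a row changes at most the sign,
-- and that the identity has determinant one. Monicity is read off by following the X-coefficients
-- of XI - A through the exterior product.
--
-- The solution of the linear system must again consist of polynomials, so elimination
-- cross-multiplies instead of dividing, and choosing a pivot constructively requires deciding
-- whether an element is zero. Hence the notion of a discrete domain, carried from ℚ to
-- ℚ[x₀, ..., xₖ₋₁] one indeterminate at a time. The weights are fixed by the n equations before any
-- exponent is considered, which is why they do not depend on m.

module PolynomialRing {c ℓ} (R : CommutativeRing c ℓ) where
  open CommutativeRing R
  open Univariate rawRing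
  open RingProperties ring using (-0#≈0#)
  open CommutativeSemigroupProperties +-commutativeSemigroup using (interchange; x∙yz≈y∙xz)
  open SetoidReasoning setoid

  coeff-+ : ∀ p q i → coeff (p +ₚ q) i ≈ coeff p i + coeff q i
  coeff-+ []      q       i       = sym (+-identityˡ _)
  coeff-+ (a ∷ p) []      i       = sym (+-identityʳ _)
  coeff-+ (a ∷ p) (b ∷ q) zero    = refl
  coeff-+ (a ∷ p) (b ∷ q) (suc i) = coeff-+ p q i

  coeff-neg : ∀ p i → coeff (map (-_) p) i ≈ - coeff p i
  coeff-neg []      i       = sym -0#≈0#
  coeff-neg (a ∷ p) zero    = refl
  coeff-neg (a ∷ p) (suc i) = coeff-neg p i

  coeff-scale : ∀ a p i → coeff (map (a *_) p) i ≈ a * coeff p i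
  coeff-scale a []      i       = sym (zeroʳ a)
  coeff-scale a (b ∷ p) zero    = refl
  coeff-scale a (b ∷ p) (suc i) = coeff-scale a p i

  coeff-*-zero : ∀ a p q → coeff ((a ∷ p) *ₚ q) 0 ≈ a * coeff q 0
  coeff-*-zero a p q = begin
    coeff ((a ∷ p) *ₚ q) 0          ≈⟨ coeff-+ (map (a *_) q) _ 0 ⟩
    coeff (map (a *_) q) 0 + 0#     ≈⟨ +-identityʳ _ ⟩
    coeff (map (a *_) q) 0          ≈⟨ coeff-scale a q 0 ⟩
    a * coeff q 0                   ∎

  coeff-*-suc : ∀ a p q i →
    coeff ((a ∷ p) *ₚ q) (suc i) ≈ a * coeff q (suc i) + coeff (p *ₚ q) i
  coeff-*-suc a p q i =
    trans (coeff-+ (map (a *_) q) _ (suc i)) (+-congʳ (coeff-scale a q (suc i)))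

  *ₚ-congˡ : ∀ p q r → q ≈ₚ r → (p *ₚ q) ≈ₚ (p *ₚ r)
  *ₚ-congˡ []      q r q≈r i       = refl
  *ₚ-congˡ (a ∷ p) q r q≈r zero    = begin
    coeff ((a ∷ p) *ₚ q) 0  ≈⟨ coeff-*-zero a p q ⟩
    a * coeff q 0           ≈⟨ *-congˡ (q≈r 0) ⟩
    a * coeff r 0           ≈⟨ coeff-*-zero a p r ⟨
    coeff ((a ∷ p) *ₚ r) 0  ∎
  *ₚ-congˡ (a ∷ p) q r q≈r (suc i) = begin
    coeff ((a ∷ p) *ₚ q) (suc i)              ≈⟨ coeff-*-suc a p q i ⟩
    a * coeff q (suc i) + coeff (p *ₚ q) i    ≈⟨ +-cong (*-congˡ (q≈r (suc i))) (*ₚ-congˡ p q r q≈r i) ⟩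
    a * coeff r (suc i) + coeff (p *ₚ r) i    ≈⟨ coeff-*-suc a p r i ⟨
    coeff ((a ∷ p) *ₚ r) (suc i)              ∎

  *ₚ-distribˡ : ∀ p q r → (p *ₚ (q +ₚ r)) ≈ₚ ((p *ₚ q) +ₚ (p *ₚ r))
  *ₚ-distribˡ []      q r i       = refl
  *ₚ-distribˡ (a ∷ p) q r zero    = begin
    coeff ((a ∷ p) *ₚ (q +ₚ r)) 0                    ≈⟨ coeff-*-zero a p (q +ₚ r) ⟩
    a * coeff (q +ₚ r) 0                             ≈⟨ *-congˡ (coeff-+ q r 0) ⟩
    a * (coeff q 0 + coeff r 0)                      ≈⟨ distribˡ a _ _ ⟩
    a * coeff q 0 + a * coeff r 0                    ≈⟨ +-cong (coeff-*-zero a p q) (coeff-*-zero a p r) ⟨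
    coeff ((a ∷ p) *ₚ q) 0 + coeff ((a ∷ p) *ₚ r) 0  ≈⟨ coeff-+ ((a ∷ p) *ₚ q) _ 0 ⟨
    coeff (((a ∷ p) *ₚ q) +ₚ ((a ∷ p) *ₚ r)) 0       ∎
  *ₚ-distribˡ (a ∷ p) q r (suc i) = begin
    coeff ((a ∷ p) *ₚ (q +ₚ r)) (suc i)
      ≈⟨ coeff-*-suc a p (q +ₚ r) i ⟩
    a * coeff (q +ₚ r) (suc i) + coeff (p *ₚ (q +ₚ r)) i
      ≈⟨ +-cong (*-congˡ (coeff-+ q r (suc i))) (trans (*ₚ-distribˡ p q r i) (coeff-+ (p *ₚ q) _ i)) ⟩
    a * (coeff q (suc i) + coeff r (suc i)) + (coeff (p *ₚ q) i + coeff (p *ₚ r) i)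
      ≈⟨ +-congʳ (distribˡ a _ _) ⟩
    (a * coeff q (suc i) + a * coeff r (suc i)) + (coeff (p *ₚ q) i + coeff (p *ₚ r) i)
      ≈⟨ interchange _ _ _ _ ⟩
    (a * coeff q (suc i) + coeff (p *ₚ q) i) + (a * coeff r (suc i) + coeff (p *ₚ r) i)
      ≈⟨ +-cong (coeff-*-suc a p q i) (coeff-*-suc a p r i) ⟨
    coeff ((a ∷ p) *ₚ q) (suc i) + coeff ((a ∷ p) *ₚ r) (suc i)
      ≈⟨ coeff-+ ((a ∷ p) *ₚ q) _ (suc i) ⟨
    coeff (((a ∷ p) *ₚ q) +ₚ ((a ∷ p) *ₚ r)) (suc i) ∎

  coeff-*-∷-zero : ∀ p b q → coeff (p *ₚ (b ∷ q)) 0 ≈ coeff p 0 * b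
  coeff-*-∷-zero []      b q = sym (zeroˡ b)
  coeff-*-∷-zero (a ∷ p) b q = coeff-*-zero a p (b ∷ q)

  -- `_*ₚ_` recurses on its left factor; this is the mirror recursion on the right factor. Comparing
  -- the two gives commutativity, from which the right-hand laws follow.
  coeff-*-∷-suc : ∀ p b q i →
    coeff (p *ₚ (b ∷ q)) (suc i) ≈ coeff p (suc i) * b + coeff (p *ₚ q) i
  coeff-*-∷-suc []      b q i       = sym (trans (+-identityʳ _) (zeroˡ b))
  coeff-*-∷-suc (a ∷ p) b q zero    = begin
    coeff ((a ∷ p) *ₚ (b ∷ q)) 1                ≈⟨ coeff-*-suc a p (b ∷ q) 0 ⟩
    a * coeff q 0 + coeff (p *ₚ (b ∷ q)) 0      ≈⟨ +-comm _ _ ⟩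
    coeff (p *ₚ (b ∷ q)) 0 + a * coeff q 0      ≈⟨ +-cong (coeff-*-∷-zero p b q) (sym (coeff-*-zero a p q)) ⟩
    coeff p 0 * b + coeff ((a ∷ p) *ₚ q) 0      ∎
  coeff-*-∷-suc (a ∷ p) b q (suc i) = begin
    coeff ((a ∷ p) *ₚ (b ∷ q)) (suc (suc i))
      ≈⟨ coeff-*-suc a p (b ∷ q) (suc i) ⟩
    a * coeff q (suc i) + coeff (p *ₚ (b ∷ q)) (suc i)
      ≈⟨ +-congˡ (coeff-*-∷-suc p b q i) ⟩
    a * coeff q (suc i) + (coeff p (suc i) * b + coeff (p *ₚ q) i)
      ≈⟨ x∙yz≈y∙xz _ _ _ ⟩
    coeff p (suc i) * b + (a * coeff q (suc i) + coeff (p *ₚ q) i)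
      ≈⟨ +-congˡ (coeff-*-suc a p q i) ⟨
    coeff p (suc i) * b + coeff ((a ∷ p) *ₚ q) (suc i) ∎

  *ₚ-zeroʳ : ∀ p → (p *ₚ []) ≈ₚ []
  *ₚ-zeroʳ []      i       = refl
  *ₚ-zeroʳ (a ∷ p) zero    = refl
  *ₚ-zeroʳ (a ∷ p) (suc i) = *ₚ-zeroʳ p i

  *ₚ-comm : ∀ p q → (p *ₚ q) ≈ₚ (q *ₚ p)
  *ₚ-comm []      q i       = sym (*ₚ-zeroʳ q i)
  *ₚ-comm (a ∷ p) q zero    = begin
    coeff ((a ∷ p) *ₚ q) 0  ≈⟨ coeff-*-zero a p q ⟩
    a * coeff q 0           ≈⟨ *-comm a _ ⟩
    coeff q 0 * a           ≈⟨ coeff-*-∷-zero q a p ⟨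
    coeff (q *ₚ (a ∷ p)) 0  ∎
  *ₚ-comm (a ∷ p) q (suc i) = begin
    coeff ((a ∷ p) *ₚ q) (suc i)            ≈⟨ coeff-*-suc a p q i ⟩
    a * coeff q (suc i) + coeff (p *ₚ q) i  ≈⟨ +-cong (*-comm a _) (*ₚ-comm p q i) ⟩
    coeff q (suc i) * a + coeff (q *ₚ p) i  ≈⟨ coeff-*-∷-suc q a p i ⟨
    coeff (q *ₚ (a ∷ p)) (suc i)            ∎

  *ₚ-distribʳ : ∀ p q r → ((q +ₚ r) *ₚ p) ≈ₚ ((q *ₚ p) +ₚ (r *ₚ p))
  *ₚ-distribʳ p q r i = begin
    coeff ((q +ₚ r) *ₚ p) i                ≈⟨ *ₚ-comm (q +ₚ r) p i ⟩
    coeff (p *ₚ (q +ₚ r)) i                ≈⟨ *ₚ-distribˡ p q r i ⟩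
    coeff ((p *ₚ q) +ₚ (p *ₚ r)) i         ≈⟨ coeff-+ (p *ₚ q) _ i ⟩
    coeff (p *ₚ q) i + coeff (p *ₚ r) i    ≈⟨ +-cong (*ₚ-comm p q i) (*ₚ-comm p r i) ⟩
    coeff (q *ₚ p) i + coeff (r *ₚ p) i    ≈⟨ coeff-+ (q *ₚ p) _ i ⟨
    coeff ((q *ₚ p) +ₚ (r *ₚ p)) i         ∎

  *ₚ-congʳ : ∀ p q r → q ≈ₚ r → (q *ₚ p) ≈ₚ (r *ₚ p)
  *ₚ-congʳ p q r q≈r i = begin
    coeff (q *ₚ p) i  ≈⟨ *ₚ-comm q p i ⟩
    coeff (p *ₚ q) i  ≈⟨ *ₚ-congˡ p q r q≈r i ⟩
    coeff (p *ₚ r) i  ≈⟨ *ₚ-comm p r i ⟩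
    coeff (r *ₚ p) i  ∎

  scale-* : ∀ a p q i → coeff (map (a *_) p *ₚ q) i ≈ a * coeff (p *ₚ q) i
  scale-* a []      q i       = sym (zeroʳ a)
  scale-* a (b ∷ p) q zero    = begin
    coeff (((a * b) ∷ map (a *_) p) *ₚ q) 0  ≈⟨ coeff-*-zero (a * b) (map (a *_) p) q ⟩
    (a * b) * coeff q 0                      ≈⟨ *-assoc a b _ ⟩
    a * (b * coeff q 0)                      ≈⟨ *-congˡ (coeff-*-zero b p q) ⟨
    a * coeff ((b ∷ p) *ₚ q) 0               ∎
  scale-* a (b ∷ p) q (suc i) = begin
    coeff (((a * b) ∷ map (a *_) p) *ₚ q) (suc i)
      ≈⟨ coeff-*-suc (a * b) (map (a *_) p) q i ⟩
    (a * b) * coeff q (suc i) + coeff (map (a *_) p *ₚ q) i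
      ≈⟨ +-cong (*-assoc a b _) (scale-* a p q i) ⟩
    a * (b * coeff q (suc i)) + a * coeff (p *ₚ q) i
      ≈⟨ distribˡ a _ _ ⟨
    a * (b * coeff q (suc i) + coeff (p *ₚ q) i)
      ≈⟨ *-congˡ (coeff-*-suc b p q i) ⟨
    a * coeff ((b ∷ p) *ₚ q) (suc i) ∎

  *ₚ-assoc : ∀ p q r → ((p *ₚ q) *ₚ r) ≈ₚ (p *ₚ (q *ₚ r))
  *ₚ-assoc []      q r i = refl
  *ₚ-assoc (a ∷ p) q r i = begin
    coeff ((map (a *_) q +ₚ (0# ∷ (p *ₚ q))) *ₚ r) i
      ≈⟨ *ₚ-distribʳ r (map (a *_) q) (0# ∷ (p *ₚ q)) i ⟩
    coeff ((map (a *_) q *ₚ r) +ₚ ((0# ∷ (p *ₚ q)) *ₚ r)) i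
      ≈⟨ coeff-+ (map (a *_) q *ₚ r) _ i ⟩
    coeff (map (a *_) q *ₚ r) i + coeff ((0# ∷ (p *ₚ q)) *ₚ r) i
      ≈⟨ +-congʳ (scale-* a q r i) ⟩
    a * coeff (q *ₚ r) i + coeff ((0# ∷ (p *ₚ q)) *ₚ r) i
      ≈⟨ lastStep i ⟩
    coeff ((a ∷ p) *ₚ (q *ₚ r)) i ∎
    where
    lastStep : ∀ i → a * coeff (q *ₚ r) i + coeff ((0# ∷ (p *ₚ q)) *ₚ r) i
                     ≈ coeff ((a ∷ p) *ₚ (q *ₚ r)) i
    lastStep zero = begin
      a * coeff (q *ₚ r) 0 + coeff ((0# ∷ (p *ₚ q)) *ₚ r) 0
        ≈⟨ +-congˡ (trans (coeff-*-zero 0# (p *ₚ q) r) (zeroˡ _)) ⟩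
      a * coeff (q *ₚ r) 0 + 0#
        ≈⟨ +-identityʳ _ ⟩
      a * coeff (q *ₚ r) 0
        ≈⟨ coeff-*-zero a p (q *ₚ r) ⟨
      coeff ((a ∷ p) *ₚ (q *ₚ r)) 0 ∎
    lastStep (suc i) = begin
      a * coeff (q *ₚ r) (suc i) + coeff ((0# ∷ (p *ₚ q)) *ₚ r) (suc i)
        ≈⟨ +-congˡ (coeff-*-suc 0# (p *ₚ q) r i) ⟩
      a * coeff (q *ₚ r) (suc i) + (0# * coeff r (suc i) + coeff ((p *ₚ q) *ₚ r) i)
        ≈⟨ +-congˡ (trans (+-congʳ (zeroˡ _)) (+-identityˡ _)) ⟩
      a * coeff (q *ₚ r) (suc i) + coeff ((p *ₚ q) *ₚ r) i
        ≈⟨ +-congˡ (*ₚ-assoc p q r i) ⟩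
      a * coeff (q *ₚ r) (suc i) + coeff (p *ₚ (q *ₚ r)) i
        ≈⟨ coeff-*-suc a p (q *ₚ r) i ⟨
      coeff ((a ∷ p) *ₚ (q *ₚ r)) (suc i) ∎

  *ₚ-identityˡ : ∀ p → (const 1# *ₚ p) ≈ₚ p
  *ₚ-identityˡ p zero    = trans (coeff-*-zero 1# [] p) (*-identityˡ _)
  *ₚ-identityˡ p (suc i) =
    trans (coeff-*-suc 1# [] p i) (trans (+-identityʳ _) (*-identityˡ _))

  ≈ₚ-isEquivalence : IsEquivalence _≈ₚ_
  ≈ₚ-isEquivalence = record
    { refl  = λ i → refl
    ; sym   = λ p≈q i → sym (p≈q i)
    ; trans = λ p≈q q≈r i → trans (p≈q i) (q≈r i)
    }

  polyIsCommutativeRing :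
    IsCommutativeRing _≈ₚ_ _+ₚ_ _*ₚ_ (map (-_)) [] (const 1#)
  polyIsCommutativeRing = record
    { isRing = record
      { +-isAbelianGroup = record
        { isGroup = record
          { isMonoid = record
            { isSemigroup = record
              { isMagma = record
                { isEquivalence = ≈ₚ-isEquivalence
                ; ∙-cong = λ {p} {q} {r} {s} p≈q r≈s i →
                    trans (coeff-+ p r i)
                      (trans (+-cong (p≈q i) (r≈s i)) (sym (coeff-+ q s i)))
                }
              ; assoc = λ p q r i → begin
                  coeff ((p +ₚ q) +ₚ r) i              ≈⟨ coeff-+ (p +ₚ q) r i ⟩
                  coeff (p +ₚ q) i + coeff r i         ≈⟨ +-congʳ (coeff-+ p q i) ⟩
                  (coeff p i + coeff q i) + coeff r i  ≈⟨ +-assoc _ _ _ ⟩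
                  coeff p i + (coeff q i + coeff r i)  ≈⟨ +-congˡ (coeff-+ q r i) ⟨
                  coeff p i + coeff (q +ₚ r) i         ≈⟨ coeff-+ p (q +ₚ r) i ⟨
                  coeff (p +ₚ (q +ₚ r)) i              ∎
              }
            ; identity = (λ p i → refl)
                       , (λ p i → trans (coeff-+ p [] i) (+-identityʳ _))
            }
          ; inverse =
              (λ p i → trans (coeff-+ (map (-_) p) p i)
                         (trans (+-congʳ (coeff-neg p i)) (-‿inverseˡ _)))
            , (λ p i → trans (coeff-+ p (map (-_) p) i)
                         (trans (+-congˡ (coeff-neg p i)) (-‿inverseʳ _)))
          ; ⁻¹-cong = λ {p} {q} p≈q i →
              trans (coeff-neg p i) (trans (-‿cong (p≈q i)) (sym (coeff-neg q i)))
          }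
        ; comm = λ p q i →
            trans (coeff-+ p q i) (trans (+-comm _ _) (sym (coeff-+ q p i)))
        }
      ; *-cong = λ {p} {q} {r} {s} p≈q r≈s i →
          trans (*ₚ-congˡ p r s r≈s i) (*ₚ-congʳ s p q p≈q i)
      ; *-assoc = *ₚ-assoc
      ; *-identity = *ₚ-identityˡ
                   , (λ p i → trans (*ₚ-comm p (const 1#) i) (*ₚ-identityˡ p i))
      ; distrib = *ₚ-distribˡ , *ₚ-distribʳ
      }
    ; *-comm = *ₚ-comm
    }

  polyCommutativeRing : CommutativeRing c ℓ
  polyCommutativeRing = record { isCommutativeRing = polyIsCommutativeRing }

-- Discrete integral domains

-- Deciding zero serves twice: elimination searches a column for a pivot, and lifting `zeroProduct`
-- to polynomials splits on whether the constant coefficient vanishes.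
record IsDiscreteDomain {c ℓ} (R : RawRing c ℓ) : Set (c ⊔ ℓ) where
  open RawRing R
  field
    isCommutativeRing : IsCommutativeRing _≈_ _+_ _*_ (-_) 0# 1#
    1≉0               : ¬ (1# ≈ 0#)
    _≈0?              : ∀ x → Dec (x ≈ 0#)
    zeroProduct       : ∀ x y → x * y ≈ 0# → x ≈ 0# ⊎ y ≈ 0#

  commutativeRing : CommutativeRing c ℓ
  commutativeRing = record { isCommutativeRing = isCommutativeRing }

module _ {c ℓ} {R : RawRing c ℓ} (domain : IsDiscreteDomain R) where
  open IsDiscreteDomain domain
  open CommutativeRing commutativeRing hiding (isCommutativeRing)
  open Univariate R
  open PolynomialRing commutativeRing

  _≈ₚ0? : ∀ p → Dec (p ≈ₚ [])
  []      ≈ₚ0? = yes λ i → refl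
  (a ∷ p) ≈ₚ0? with a ≈0? | p ≈ₚ0?
  ... | no a≉0  | _       = no λ ap≈0 → a≉0 (ap≈0 0)
  ... | yes _   | no p≉0  = no λ ap≈0 → p≉0 λ i → ap≈0 (suc i)
  ... | yes a≈0 | yes p≈0 = yes λ { zero → a≈0 ; (suc i) → p≈0 i }

  -- The lowest coefficient of the product is `a * b`, so `b` vanishes, X can be divided out of the
  -- second factor, and the argument repeats. Working from the lowest coefficient avoids degrees,
  -- which trailing zeros would obscure.
  nonzeroConstantCancels : ∀ a p q → ¬ (a ≈ 0#) → ((a ∷ p) *ₚ q) ≈ₚ [] → q ≈ₚ []
  nonzeroConstantCancels a p []      a≉0 apq≈0 = λ i → refl
  nonzeroConstantCancels a p (b ∷ q) a≉0 apq≈0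
    with zeroProduct a b (trans (sym (coeff-*-zero a p (b ∷ q))) (apq≈0 0))
  ... | inj₁ a≈0 = contradiction a≈0 a≉0
  ... | inj₂ b≈0 = λ { zero → b≈0 ; (suc i) → q≈0 i }
    where
    q≈0 : q ≈ₚ []
    q≈0 = nonzeroConstantCancels a p q a≉0 λ i → begin
      coeff ((a ∷ p) *ₚ q) i                          ≈⟨ +-identityˡ _ ⟨
      0# + coeff ((a ∷ p) *ₚ q) i                     ≈⟨ +-congʳ (trans (*-congˡ b≈0) (zeroʳ _)) ⟨
      coeff p i * b + coeff ((a ∷ p) *ₚ q) i          ≈⟨ coeff-*-∷-suc (a ∷ p) b q i ⟨
      coeff ((a ∷ p) *ₚ (b ∷ q)) (suc i)              ≈⟨ apq≈0 (suc i) ⟩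
      0#                                              ∎
      where open SetoidReasoning setoid

  polyZeroProduct : ∀ p q → (p *ₚ q) ≈ₚ [] → p ≈ₚ [] ⊎ q ≈ₚ []
  polyZeroProduct []      q pq≈0 = inj₁ λ i → refl
  polyZeroProduct (a ∷ p) q pq≈0 with a ≈0?
  ... | no a≉0  = inj₂ (nonzeroConstantCancels a p q a≉0 pq≈0)
  -- With vanishing constant coefficient the product is X times `p *ₚ q`, so X is cancelled and the
  -- search for the lowest nonzero coefficient goes on in `p`.
  ... | yes a≈0 with polyZeroProduct p q (λ i → begin
      coeff (p *ₚ q) i                             ≈⟨ +-identityˡ _ ⟨
      0# + coeff (p *ₚ q) i                        ≈⟨ +-congʳ (trans (*-congʳ a≈0) (zeroˡ _)) ⟨
      a * coeff q (suc i) + coeff (p *ₚ q) i       ≈⟨ coeff-*-suc a p q i ⟨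
      coeff ((a ∷ p) *ₚ q) (suc i)                 ≈⟨ pq≈0 (suc i) ⟩
      0#                                           ∎)
      where open SetoidReasoning setoid
  ...   | inj₁ p≈0 = inj₁ λ { zero → a≈0 ; (suc i) → p≈0 i }
  ...   | inj₂ q≈0 = inj₂ q≈0

  polyIsDiscreteDomain : IsDiscreteDomain polyRawRing
  polyIsDiscreteDomain = record
    { isCommutativeRing = polyIsCommutativeRing
    ; 1≉0               = λ 1≈0 → 1≉0 (1≈0 0)
    ; _≈0?              = _≈ₚ0?
    ; zeroProduct       = polyZeroProduct
    }

-- Polynomial rings over ℚ as discrete domains

ℚ-zeroProduct : ∀ x y → x ℚ.* y ≡ 0ℚ → x ≡ 0ℚ ⊎ y ≡ 0ℚ
ℚ-zeroProduct x y xy≡0 with x ℚ.≟ 0ℚ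
... | yes x≡0 = inj₁ x≡0
... | no  x≢0 = inj₂ (begin
  y                  ≡⟨ ℚ.*-identityˡ y ⟨
  ℚ.1ℚ ℚ.* y         ≡⟨ ≡.cong (ℚ._* y) (ℚ.*-inverseˡ x) ⟨
  (1/x ℚ.* x) ℚ.* y  ≡⟨ ℚ.*-assoc 1/x x y ⟩
  1/x ℚ.* (x ℚ.* y)  ≡⟨ ≡.cong (1/x ℚ.*_) xy≡0 ⟩
  1/x ℚ.* 0ℚ         ≡⟨ ℚ.*-zeroʳ 1/x ⟩
  0ℚ                 ∎)
  where
  open ≡-Reasoning
  instance
    x-nonZero : ℚ.NonZero x
    x-nonZero = ℚ.≢-nonZero x≢0
  1/x : ℚ
  1/x = ℚ.1/ x

ℚ[_]-isDiscreteDomain : ∀ k → IsDiscreteDomain ℚ[ k ]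
ℚ[ zero ]-isDiscreteDomain = record
  { isCommutativeRing = ℚ.+-*-isCommutativeRing
  ; 1≉0               = ℚ.1≢0
  ; _≈0?              = ℚ._≟ 0ℚ
  ; zeroProduct       = ℚ-zeroProduct
  }
ℚ[ suc k ]-isDiscreteDomain = polyIsDiscreteDomain ℚ[ k ]-isDiscreteDomain

-- Underdetermined linear systems

module Underdetermined {c ℓ} {R : RawRing c ℓ} (domain : IsDiscreteDomain R) where
  open IsDiscreteDomain domain
  open CommutativeRing commutativeRing hiding (isCommutativeRing; zero) renaming (_*_ to _·_)
  open SemiringSum semiring
  open RingProperties ring using (-‿distribˡ-*; x[y-z]≈xy-xz)
  open CommutativeSemigroupProperties *-commutativeSemigroup using (x∙yz≈y∙xz)
  open SetoidReasoning setoid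

  -- Fraction-free Gaussian elimination.
  underdetermined : ∀ n (A : Fin n → Fin (suc n) → Carrier) →
    Σ (Fin (suc n) → Carrier) λ x →
      (∃ λ j → ¬ (x j ≈ 0#)) × (∀ i → sum (λ j → x j · A i j) ≈ 0#)
  underdetermined zero    A = (λ _ → 1#) , (zero , 1≉0) , λ ()
  underdetermined (suc n) A with all? (λ i → A i zero ≈0?)
  -- A vanishing first column leaves the first unknown free, so the first unit vector is a solution.
  ... | yes column≈0 = x , (zero , 1≉0) , solves
    where
    x : Fin (suc (suc n)) → Carrier
    x zero    = 1#
    x (suc j) = 0#
    solves : ∀ i → sum (λ j → x j · A i j) ≈ 0#
    solves i = begin
      1# · A i zero + sum (λ j → 0# · A i (suc j))
        ≈⟨ +-cong (trans (*-identityˡ _) (column≈0 i)) (sum-cong-≋ {suc n} (λ j → zeroˡ (A i (suc j)))) ⟩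
      0# + sum {suc n} (λ j → 0#)
        ≈⟨ trans (+-identityˡ _) (sum-replicate-zero (suc n)) ⟩
      0# ∎
  ... | no column≉0 with ¬∀⟶∃¬ (suc n) _ (λ i → A i zero ≈0?) column≉0
  ...   | i₀ , a≉0 = x , (suc j₀ , ayⱼ≉0) , solves
    where
    a = A i₀ zero
    eliminated : Fin n → Fin (suc n) → Carrier
    eliminated i j = a · A (punchIn i₀ i) (suc j) - A (punchIn i₀ i) zero · A i₀ (suc j)
    solution = underdetermined n eliminated
    y = proj₁ solution
    j₀ = proj₁ (proj₁ (proj₂ solution))
    pivotTail = sum (λ j → y j · A i₀ (suc j))
    -- Back substitution without division: scaling `y` by the pivot `a` turns the pivot equation
    -- into a · x₀ + a · `pivotTail` = 0, which - `pivotTail` solves. The scaled solution stays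
    -- nonzero because the ring is a domain and `a` is nonzero.
    x : Fin (suc (suc n)) → Carrier
    x zero    = - pivotTail
    x (suc j) = a · y j

    ayⱼ≉0 : ¬ (a · y j₀ ≈ 0#)
    ayⱼ≉0 ay≈0 with zeroProduct a (y j₀) ay≈0
    ... | inj₁ a≈0 = a≉0 a≈0
    ... | inj₂ y≈0 = proj₂ (proj₁ (proj₂ solution)) y≈0

    row : ∀ i → sum (λ j → x j · A i j)
                ≈ - (A i zero · pivotTail) + a · sum (λ j → y j · A i (suc j))
    row i = +-cong
      (trans (sym (-‿distribˡ-* _ _)) (-‿cong (*-comm _ _)))
      (trans (sum-cong-≋ {suc n} (λ j → *-assoc a (y j) (A i (suc j))))
             (sym (*-distribˡ-sum {suc n} a (λ j → y j · A i (suc j)))))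

    solvesPivot : sum (λ j → x j · A i₀ j) ≈ 0#
    solvesPivot = trans (row i₀) (-‿inverseˡ _)

    eliminatedRow : ∀ i → sum (λ j → y j · eliminated i j)
      ≈ a · sum (λ j → y j · A (punchIn i₀ i) (suc j)) - A (punchIn i₀ i) zero · pivotTail
    eliminatedRow i = begin
      sum (λ j → y j · (a · r j - b · A i₀ (suc j)))
        ≈⟨ sum-cong-≋ {suc n} (λ j → expand (y j) (r j) (A i₀ (suc j))) ⟩
      sum (λ j → a · (y j · r j) + (- b) · (y j · A i₀ (suc j)))
        ≈⟨ ∑-distrib-+ {suc n} (λ j → a · (y j · r j)) (λ j → (- b) · (y j · A i₀ (suc j))) ⟩
      sum (λ j → a · (y j · r j)) + sum (λ j → (- b) · (y j · A i₀ (suc j)))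
        ≈⟨ +-cong (*-distribˡ-sum {suc n} a (λ j → y j · r j))
                  (*-distribˡ-sum {suc n} (- b) (λ j → y j · A i₀ (suc j))) ⟨
      a · sum (λ j → y j · r j) + (- b) · pivotTail
        ≈⟨ +-congˡ (-‿distribˡ-* _ _) ⟨
      a · sum (λ j → y j · r j) - b · pivotTail ∎
      where
      b = A (punchIn i₀ i) zero
      r : Fin (suc n) → Carrier
      r j = A (punchIn i₀ i) (suc j)
      expand : ∀ y r p → y · (a · r - b · p) ≈ a · (y · r) + (- b) · (y · p)
      expand y r p = begin
        y · (a · r - b · p)              ≈⟨ x[y-z]≈xy-xz _ _ _ ⟩
        y · (a · r) - y · (b · p)        ≈⟨ +-cong (x∙yz≈y∙xz _ _ _) (-‿cong (x∙yz≈y∙xz _ _ _)) ⟩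
        a · (y · r) - b · (y · p)        ≈⟨ +-congˡ (-‿distribˡ-* _ _) ⟩
        a · (y · r) + (- b) · (y · p)    ∎

    solves : ∀ i → sum (λ j → x j · A i j) ≈ 0#
    solves i with i₀ Fin.≟ i
    ... | yes ≡.refl = solvesPivot
    -- On any other row, substituting `x` gives exactly the eliminated equation at `y`.
    ... | no i₀≢i    = ≡.subst (λ k → sum (λ j → x j · A k j) ≈ 0#) (punchIn-punchOut i₀≢i) (begin
      sum (λ j → x j · A (punchIn i₀ i′) j)
        ≈⟨ trans (row (punchIn i₀ i′)) (+-comm _ _) ⟩
      a · sum (λ j → y j · A (punchIn i₀ i′) (suc j)) - A (punchIn i₀ i′) zero · pivotTail
        ≈⟨ eliminatedRow i′ ⟨
      sum (λ j → y j · eliminated i′ j)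
        ≈⟨ proj₂ (proj₂ solution) i′ ⟩
      0# ∎)
      where i′ = punchOut i₀≢i

  -- Linear systems with unknowns indexed by a subset

  element : ∀ {k} (S : Subset k) → Fin ∣ S ∣ → Fin k
  element (inside  ∷ S) zero    = zero
  element (inside  ∷ S) (suc l) = suc (element S l)
  element (outside ∷ S) l       = suc (element S l)

  element-∈ : ∀ {k} (S : Subset k) l → element S l ∈ S
  element-∈ (inside  ∷ S) zero    = here
  element-∈ (inside  ∷ S) (suc l) = there (element-∈ S l)
  element-∈ (outside ∷ S) l       = there (element-∈ S l)

  extendByZero : ∀ {k} (S : Subset k) → (Fin ∣ S ∣ → Carrier) → Fin k → Carrier
  extendByZero (inside  ∷ S) x zero    = x zero
  extendByZero (inside  ∷ S) x (suc s) = extendByZero S (x ∘ suc) s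
  extendByZero (outside ∷ S) x zero    = 0#
  extendByZero (outside ∷ S) x (suc s) = extendByZero S x s

  extendByZero-element : ∀ {k} (S : Subset k) x l → extendByZero S x (element S l) ≡ x l
  extendByZero-element (inside  ∷ S) x zero    = ≡.refl
  extendByZero-element (inside  ∷ S) x (suc l) = extendByZero-element S (x ∘ suc) l
  extendByZero-element (outside ∷ S) x l       = extendByZero-element S x l

  sumOver-extendByZero : ∀ {k} (S : Subset k) x (f : Fin k → Carrier) →
    sumOver R S (λ s → extendByZero S x s · f s) ≈ sum (λ l → x l · f (element S l))
  sumOver-extendByZero []            x f = refl
  sumOver-extendByZero (inside  ∷ S) x f = +-congˡ (sumOver-extendByZero S (x ∘ suc) (f ∘ suc))
  sumOver-extendByZero (outside ∷ S) x f =
    trans (+-identityˡ _) (sumOver-extendByZero S x (f ∘ suc))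

  underdeterminedOver : ∀ {k} n (S : Subset k) → ∣ S ∣ ≡ suc n → (A : Fin n → Fin k → Carrier) →
    Σ (Fin k → Carrier) λ q →
      (∃ λ s → s ∈ S × ¬ (q s ≈ 0#)) × (∀ i → sumOver R S (λ s → q s · A i s) ≈ 0#)
  underdeterminedOver n S ∣S∣≡1+n A =
    q , (element S l , element-∈ S l , qₗ≉0) ,
    λ i → trans (sumOver-extendByZero S x (A i)) (solves i)
    where
    -- The cardinality is generalised to a variable `m` so that the equation can be matched with
    -- `refl`; `∣ S ∣` itself does not unify with `suc n`.
    nonzeroSolution : ∀ {m} → m ≡ suc n → (B : Fin n → Fin m → Carrier) →
      Σ (Fin m → Carrier) λ x →
        (∃ λ l → ¬ (x l ≈ 0#)) × (∀ i → sum (λ l → x l · B i l) ≈ 0#)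
    nonzeroSolution ≡.refl = underdetermined n
    solution = nonzeroSolution ∣S∣≡1+n (λ i l → A i (element S l))
    x = proj₁ solution
    l = proj₁ (proj₁ (proj₂ solution))
    solves = proj₂ (proj₂ solution)
    q = extendByZero S x
    qₗ≉0 : ¬ (q (element S l) ≈ 0#)
    qₗ≉0 q≈0 = proj₂ (proj₁ (proj₂ solution))
      (trans (reflexive (≡.sym (extendByZero-element S x l))) q≈0)

-- Exterior algebra and determinants

module LeftModuleProperties {c ℓ m ℓm} (R : CommutativeRing c ℓ)
  (M : LeftModule (CommutativeRing.ring R) m ℓm) where
  open CommutativeRing R using (Carrier; _+_; _*_; -_; 0#; -‿inverseʳ; *-comm)
  open LeftModule M
  open AbelianGroupProperties +ᴹ-abelianGroup using (inverseʳ-unique)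
  open SetoidReasoning ≈ᴹ-setoid
  open CommutativeMonoidSum +ᴹ-commutativeMonoid using (sum)

  *ₗ-negʳ : ∀ r x → r *ₗ (-ᴹ x) ≈ᴹ -ᴹ (r *ₗ x)
  *ₗ-negʳ r x = inverseʳ-unique (r *ₗ x) (r *ₗ (-ᴹ x)) (begin
    r *ₗ x +ᴹ r *ₗ (-ᴹ x)   ≈⟨ *ₗ-distribˡ r x (-ᴹ x) ⟨
    r *ₗ (x +ᴹ -ᴹ x)        ≈⟨ *ₗ-congˡ (-ᴹ‿inverseʳ x) ⟩
    r *ₗ 0ᴹ                 ≈⟨ *ₗ-zeroʳ r ⟩
    0ᴹ                      ∎)

  *ₗ-negˡ : ∀ r x → (- r) *ₗ x ≈ᴹ -ᴹ (r *ₗ x)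
  *ₗ-negˡ r x = inverseʳ-unique (r *ₗ x) ((- r) *ₗ x) (begin
    r *ₗ x +ᴹ (- r) *ₗ x   ≈⟨ *ₗ-distribʳ x r (- r) ⟨
    (r + - r) *ₗ x         ≈⟨ *ₗ-congʳ (-‿inverseʳ r) ⟩
    0# *ₗ x                ≈⟨ *ₗ-zeroˡ x ⟩
    0ᴹ                     ∎)

  *ₗ-swap : ∀ r s x → r *ₗ (s *ₗ x) ≈ᴹ s *ₗ (r *ₗ x)
  *ₗ-swap r s x = begin
    r *ₗ (s *ₗ x)  ≈⟨ *ₗ-assoc r s x ⟨
    (r * s) *ₗ x   ≈⟨ *ₗ-congʳ (*-comm r s) ⟩
    (s * r) *ₗ x   ≈⟨ *ₗ-assoc s r x ⟩
    s *ₗ (r *ₗ x)  ∎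

  *ₗ-distribˡ-sum : ∀ n r (x : Fin n → Carrierᴹ) →
    r *ₗ sum x ≈ᴹ sum (λ i → r *ₗ x i)
  *ₗ-distribˡ-sum zero    r x = *ₗ-zeroʳ r
  *ₗ-distribˡ-sum (suc n) r x =
    ≈ᴹ-trans (*ₗ-distribˡ r _ _) (+ᴹ-congˡ (*ₗ-distribˡ-sum n r (x ∘ suc)))

module ExteriorAlgebra {c ℓ} (R : CommutativeRing c ℓ) where
  open CommutativeRing R hiding (zero)
  open RingProperties ring using (-0#≈0#; -1*x≈-x)

  -- The exterior algebra of Rⁿ, split along the first basis vector ε₀ as
  -- Λ Rⁿ⁺¹ = Λ Rⁿ ⊕ ε₀ ∧ Λ Rⁿ.
  Λ : ℕ → LeftModule ring c ℓ
  Λ zero    = TensorUnit.leftModule {R = ring}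
  Λ (suc n) = DirectProduct.leftModule (Λ n) (Λ n)

  module Λ (n : ℕ) where
    open LeftModule (Λ n) public
    open LeftModuleProperties R (Λ n) public
    open AbelianGroupProperties +ᴹ-abelianGroup public
      using (inverseʳ-unique; ε⁻¹≈ε; ⁻¹-∙-comm; ⁻¹-anti-homo‿-; ⁻¹-involutive)

  ∣Λ∣ : ℕ → Set c
  ∣Λ∣ n = Λ.Carrierᴹ n

  infixr 8 _∧_
  -- With (α , β) standing for α + ε₀ ∧ β and v = v₀ ε₀ + v′, this is v ∧ (α + ε₀ ∧ β) = v′ ∧ α + ε₀
  -- ∧ (v₀ α - v′ ∧ β); the minus sign comes from moving v′ past ε₀.
  _∧_ : ∀ {n} → (Fin n → Carrier) → ∣Λ∣ n → ∣Λ∣ n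
  _∧_ {zero}  v ω       = 0#
  _∧_ {suc n} v (α , β) = v′ ∧ α , v zero *ₗ α +ᴹ (-ᴹ (v′ ∧ β))
    where
    open Λ n
    v′ = v ∘ suc

  ∧-cong : ∀ n (v : Fin n → Carrier) {ω η} → Λ._≈ᴹ_ n ω η → Λ._≈ᴹ_ n (v ∧ ω) (v ∧ η)
  ∧-cong zero    v ω≈η         = refl
  ∧-cong (suc n) v (α≈γ , β≈δ) =
    ∧-cong n v′ α≈γ , +ᴹ-cong (*ₗ-congˡ α≈γ) (-ᴹ‿cong (∧-cong n v′ β≈δ))
    where
    open Λ n
    v′ = v ∘ suc

  ∧-+ : ∀ n (v : Fin n → Carrier) ω η →
    let open Λ n in v ∧ (ω +ᴹ η) ≈ᴹ v ∧ ω +ᴹ v ∧ η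
  ∧-+ zero    v ω       η       = sym (+-identityˡ 0#)
  ∧-+ (suc n) v (α , β) (γ , δ) = ∧-+ n v′ α γ , (begin
    v zero *ₗ (α +ᴹ γ) +ᴹ -ᴹ (v′ ∧ (β +ᴹ δ))
      ≈⟨ +ᴹ-cong (*ₗ-distribˡ _ _ _) (≈ᴹ-trans (-ᴹ‿cong (∧-+ n v′ β δ)) (≈ᴹ-sym (⁻¹-∙-comm _ _))) ⟩
    (v zero *ₗ α +ᴹ v zero *ₗ γ) +ᴹ (-ᴹ (v′ ∧ β) +ᴹ -ᴹ (v′ ∧ δ))
      ≈⟨ interchange _ _ _ _ ⟩
    (v zero *ₗ α +ᴹ -ᴹ (v′ ∧ β)) +ᴹ (v zero *ₗ γ +ᴹ -ᴹ (v′ ∧ δ)) ∎)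
    where
    open Λ n
    open CommutativeSemigroupProperties
      (CommutativeMonoid.commutativeSemigroup +ᴹ-commutativeMonoid) using (interchange)
    open SetoidReasoning ≈ᴹ-setoid
    v′ = v ∘ suc

  ∧-0 : ∀ n (v : Fin n → Carrier) → let open Λ n in v ∧ 0ᴹ ≈ᴹ 0ᴹ
  ∧-0 zero    v = refl
  ∧-0 (suc n) v = ∧-0 n v′ , (begin
    v zero *ₗ 0ᴹ +ᴹ -ᴹ (v′ ∧ 0ᴹ)  ≈⟨ +ᴹ-cong (*ₗ-zeroʳ _) (-ᴹ‿cong (∧-0 n v′)) ⟩
    0ᴹ +ᴹ -ᴹ 0ᴹ                   ≈⟨ -ᴹ‿inverseʳ 0ᴹ ⟩
    0ᴹ                            ∎)
    where
    open Λ n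
    open SetoidReasoning ≈ᴹ-setoid
    v′ = v ∘ suc

  ∧-neg : ∀ n (v : Fin n → Carrier) ω → let open Λ n in v ∧ (-ᴹ ω) ≈ᴹ -ᴹ (v ∧ ω)
  ∧-neg n v ω = inverseʳ-unique (v ∧ ω) (v ∧ (-ᴹ ω)) (begin
    v ∧ ω +ᴹ v ∧ (-ᴹ ω)  ≈⟨ ∧-+ n v ω (-ᴹ ω) ⟨
    v ∧ (ω +ᴹ -ᴹ ω)      ≈⟨ ∧-cong n v (-ᴹ‿inverseʳ ω) ⟩
    v ∧ 0ᴹ               ≈⟨ ∧-0 n v ⟩
    0ᴹ                   ∎)
    where
    open Λ n
    open SetoidReasoning ≈ᴹ-setoid

  ∧-scale : ∀ n (v : Fin n → Carrier) r ω → let open Λ n in v ∧ (r *ₗ ω) ≈ᴹ r *ₗ (v ∧ ω)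
  ∧-scale zero    v r ω       = sym (zeroʳ r)
  ∧-scale (suc n) v r (α , β) = ∧-scale n v′ r α , (begin
    v zero *ₗ (r *ₗ α) +ᴹ -ᴹ (v′ ∧ (r *ₗ β))
      ≈⟨ +ᴹ-cong (*ₗ-swap _ _ _) (-ᴹ‿cong (∧-scale n v′ r β)) ⟩
    r *ₗ (v zero *ₗ α) +ᴹ -ᴹ (r *ₗ (v′ ∧ β))
      ≈⟨ +ᴹ-congˡ (*ₗ-negʳ _ _) ⟨
    r *ₗ (v zero *ₗ α) +ᴹ r *ₗ (-ᴹ (v′ ∧ β))
      ≈⟨ *ₗ-distribˡ _ _ _ ⟨
    r *ₗ (v zero *ₗ α +ᴹ -ᴹ (v′ ∧ β)) ∎)
    where
    open Λ n
    open SetoidReasoning ≈ᴹ-setoid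
    v′ = v ∘ suc

  ∧-expand : ∀ n (v w : Fin n → Carrier) r α β → let open Λ n in
    v ∧ (r *ₗ α +ᴹ -ᴹ (w ∧ β)) ≈ᴹ r *ₗ (v ∧ α) +ᴹ -ᴹ (v ∧ w ∧ β)
  ∧-expand n v w r α β =
    ≈ᴹ-trans (∧-+ n v _ _) (+ᴹ-cong (∧-scale n v r α) (∧-neg n v (w ∧ β)))
    where open Λ n

  -- Over a general commutative ring anticommutativity would only give 2 (v ∧ v ∧ ω) = 0, so this
  -- has its own induction: in the ε₀ component the two terms v₀ (v′ ∧ α) cancel.
  ∧-self : ∀ n (v : Fin n → Carrier) ω → let open Λ n in v ∧ v ∧ ω ≈ᴹ 0ᴹ
  ∧-self zero    v ω       = refl
  ∧-self (suc n) v (α , β) = ∧-self n v′ α , (begin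
    r *ₗ (v′ ∧ α) +ᴹ -ᴹ (v′ ∧ (r *ₗ α +ᴹ -ᴹ (v′ ∧ β)))
      ≈⟨ +ᴹ-congˡ (-ᴹ‿cong (∧-expand n v′ v′ r α β)) ⟩
    r *ₗ (v′ ∧ α) +ᴹ -ᴹ (r *ₗ (v′ ∧ α) +ᴹ -ᴹ (v′ ∧ v′ ∧ β))
      ≈⟨ +ᴹ-congˡ (-ᴹ‿cong (+ᴹ-congˡ (≈ᴹ-trans (-ᴹ‿cong (∧-self n v′ β)) ε⁻¹≈ε))) ⟩
    r *ₗ (v′ ∧ α) +ᴹ -ᴹ (r *ₗ (v′ ∧ α) +ᴹ 0ᴹ)
      ≈⟨ +ᴹ-congˡ (-ᴹ‿cong (+ᴹ-identityʳ _)) ⟩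
    r *ₗ (v′ ∧ α) +ᴹ -ᴹ (r *ₗ (v′ ∧ α))
      ≈⟨ -ᴹ‿inverseʳ _ ⟩
    0ᴹ ∎)
    where
    open Λ n
    open SetoidReasoning ≈ᴹ-setoid
    v′ = v ∘ suc
    r = v zero

  ∧-anticomm : ∀ n (v w : Fin n → Carrier) ω →
    let open Λ n in v ∧ w ∧ ω ≈ᴹ -ᴹ (w ∧ v ∧ ω)
  ∧-anticomm zero    v w ω       = sym -0#≈0#
  ∧-anticomm (suc n) v w (α , β) = ∧-anticomm n v′ w′ α , (begin
    p +ᴹ -ᴹ (v′ ∧ (s *ₗ α +ᴹ -ᴹ (w′ ∧ β)))
      ≈⟨ +ᴹ-congˡ (-ᴹ‿cong (∧-expand n v′ w′ s α β)) ⟩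
    p +ᴹ -ᴹ (q +ᴹ -ᴹ (v′ ∧ w′ ∧ β))
      ≈⟨ +ᴹ-congˡ (⁻¹-anti-homo‿- _ _) ⟩
    p +ᴹ (v′ ∧ w′ ∧ β +ᴹ -ᴹ q)
      ≈⟨ +ᴹ-assoc _ _ _ ⟨
    (p +ᴹ v′ ∧ w′ ∧ β) +ᴹ -ᴹ q
      ≈⟨ +ᴹ-congʳ (+ᴹ-congˡ (∧-anticomm n v′ w′ β)) ⟩
    (p +ᴹ -ᴹ (w′ ∧ v′ ∧ β)) +ᴹ -ᴹ q
      ≈⟨ ⁻¹-anti-homo‿- _ _ ⟨
    -ᴹ (q +ᴹ -ᴹ (p +ᴹ -ᴹ (w′ ∧ v′ ∧ β)))
      ≈⟨ -ᴹ‿cong (+ᴹ-congˡ (-ᴹ‿cong (∧-expand n w′ v′ r α β))) ⟨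
    -ᴹ (q +ᴹ -ᴹ (w′ ∧ (r *ₗ α +ᴹ -ᴹ (v′ ∧ β)))) ∎)
    where
    open Λ n
    open SetoidReasoning ≈ᴹ-setoid
    v′ = v ∘ suc
    w′ = w ∘ suc
    r = v zero
    s = w zero
    p = r *ₗ (w′ ∧ α)
    q = s *ₗ (v′ ∧ α)

  -- Exterior products of rows and the determinant

  unit : ∀ n → ∣Λ∣ n
  unit zero    = 1#
  unit (suc n) = unit n , Λ.0ᴹ n

  ⋀ : ∀ {m n} → (Fin m → Fin n → Carrier) → ∣Λ∣ n
  ⋀ {zero}  {n} c = unit n
  ⋀ {suc m} {n} c = c zero ∧ ⋀ (c ∘ suc)

  ∧-⋀-member : ∀ m n (c : Fin m → Fin n → Carrier) j → let open Λ n in c j ∧ ⋀ c ≈ᴹ 0ᴹ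
  ∧-⋀-member (suc m) n c zero    = ∧-self n (c zero) (⋀ (c ∘ suc))
  ∧-⋀-member (suc m) n c (suc j) = begin
    c (suc j) ∧ c zero ∧ ⋀ (c ∘ suc)        ≈⟨ ∧-anticomm n _ _ _ ⟩
    -ᴹ (c zero ∧ c (suc j) ∧ ⋀ (c ∘ suc))   ≈⟨ -ᴹ‿cong (∧-cong n _ (∧-⋀-member m n (c ∘ suc) j)) ⟩
    -ᴹ (c zero ∧ 0ᴹ)                        ≈⟨ -ᴹ‿cong (∧-0 n _) ⟩
    -ᴹ 0ᴹ                                   ≈⟨ ε⁻¹≈ε ⟩
    0ᴹ                                      ∎
    where
    open Λ n
    open SetoidReasoning ≈ᴹ-setoid

  -- Returning row k from the front to its place crosses k rows, with sign (-1)ᵏ. Knowing the result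
  -- up to sign suffices for showing that the determinant annihilates a module element.
  ∧-⋀-removeAt : ∀ m n (c : Fin (suc m) → Fin n → Carrier) k → let open Λ n in
    (c k ∧ ⋀ (c ∘ punchIn k) ≈ᴹ ⋀ c) ⊎ (c k ∧ ⋀ (c ∘ punchIn k) ≈ᴹ -ᴹ ⋀ c)
  ∧-⋀-removeAt m       n c zero    = inj₁ (Λ.≈ᴹ-refl n)
  ∧-⋀-removeAt (suc m) n c (suc k) = move (∧-⋀-removeAt m n (c ∘ suc) k)
    where
    open Λ n
    open SetoidReasoning ≈ᴹ-setoid
    τ = c (suc k) ∧ ⋀ (c ∘ suc ∘ punchIn k)
    move : (τ ≈ᴹ ⋀ (c ∘ suc)) ⊎ (τ ≈ᴹ -ᴹ ⋀ (c ∘ suc)) →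
      (c (suc k) ∧ ⋀ (c ∘ punchIn (suc k)) ≈ᴹ ⋀ c) ⊎
      (c (suc k) ∧ ⋀ (c ∘ punchIn (suc k)) ≈ᴹ -ᴹ ⋀ c)
    move (inj₁ even) = inj₂ (begin
      c (suc k) ∧ c zero ∧ ⋀ (c ∘ suc ∘ punchIn k)  ≈⟨ ∧-anticomm n _ _ _ ⟩
      -ᴹ (c zero ∧ τ)                               ≈⟨ -ᴹ‿cong (∧-cong n _ even) ⟩
      -ᴹ ⋀ c                                        ∎)
    move (inj₂ odd)  = inj₁ (begin
      c (suc k) ∧ c zero ∧ ⋀ (c ∘ suc ∘ punchIn k)  ≈⟨ ∧-anticomm n _ _ _ ⟩
      -ᴹ (c zero ∧ τ)                               ≈⟨ -ᴹ‿cong (∧-cong n _ odd) ⟩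
      -ᴹ (c zero ∧ (-ᴹ ⋀ (c ∘ suc)))                ≈⟨ -ᴹ‿cong (∧-neg n _ _) ⟩
      -ᴹ (-ᴹ ⋀ c)                                   ≈⟨ ⁻¹-involutive _ ⟩
      ⋀ c                                           ∎)

  -- The coefficient of ε₀ ∧ ⋯ ∧ εₙ₋₁, reached by taking the ε₀ component at every level.
  top : ∀ n → ∣Λ∣ n → Carrier
  top zero    ω       = ω
  top (suc n) (α , β) = top n β

  top-cong : ∀ n {ω η} → Λ._≈ᴹ_ n ω η → top n ω ≈ top n η
  top-cong zero    ω≈η         = ω≈η
  top-cong (suc n) (α≈γ , β≈δ) = top-cong n β≈δ

  top-0 : ∀ n → top n (Λ.0ᴹ n) ≈ 0#
  top-0 zero    = refl
  top-0 (suc n) = top-0 n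

  top-+ : ∀ n ω η → top n (Λ._+ᴹ_ n ω η) ≈ top n ω + top n η
  top-+ zero    ω       η       = refl
  top-+ (suc n) (α , β) (γ , δ) = top-+ n β δ

  top-neg : ∀ n ω → top n (Λ.-ᴹ_ n ω) ≈ - top n ω
  top-neg zero    ω       = refl
  top-neg (suc n) (α , β) = top-neg n β

  top-scale : ∀ n r ω → top n (Λ._*ₗ_ n r ω) ≈ r * top n ω
  top-scale zero    r ω       = refl
  top-scale (suc n) r (α , β) = top-scale n r β

  -- For c : Fin n → Fin n → R this is the determinant of the matrix with rows c i.
  det : ∀ {m n} → (Fin m → Fin n → Carrier) → Carrier
  det {n = n} c = top n (⋀ c)

  -- Vectors without ε₀ component have their exterior product in the summand Λ Rⁿ. Applied to the
  -- lower rows of the identity, this is the expansion behind `det-identity`.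
  ⋀-zeroFirstColumn : ∀ m n (c : Fin m → Fin (suc n) → Carrier) → (∀ i → c i zero ≈ 0#) →
    Λ._≈ᴹ_ (suc n) (⋀ c) (⋀ (λ i → c i ∘ suc) , Λ.0ᴹ n)
  ⋀-zeroFirstColumn zero    n c c₀≈0 = Λ.≈ᴹ-refl (suc n)
  ⋀-zeroFirstColumn (suc m) n c c₀≈0 =
    Λ.≈ᴹ-trans (suc n) (∧-cong (suc n) (c zero) (⋀-zeroFirstColumn m n (c ∘ suc) (c₀≈0 ∘ suc)))
      (≈ᴹ-refl , (begin
        c zero zero *ₗ ω +ᴹ -ᴹ (c₀′ ∧ 0ᴹ)  ≈⟨ +ᴹ-cong (*ₗ-congʳ (c₀≈0 zero)) (-ᴹ‿cong (∧-0 n c₀′)) ⟩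
        0# *ₗ ω +ᴹ -ᴹ 0ᴹ                   ≈⟨ +ᴹ-cong (*ₗ-zeroˡ ω) ε⁻¹≈ε ⟩
        0ᴹ +ᴹ 0ᴹ                           ≈⟨ +ᴹ-identityˡ 0ᴹ ⟩
        0ᴹ                                 ∎))
    where
    open Λ n
    open SetoidReasoning ≈ᴹ-setoid
    ω = ⋀ (λ i → c (suc i) ∘ suc)
    c₀′ = c zero ∘ suc

  det-identity : ∀ n → det (identity rawRing {n}) ≈ 1#
  det-identity zero    = refl
  det-identity (suc n) = begin
    top n (proj₂ (I zero ∧ ⋀ (I ∘ suc)))
      ≈⟨ top-cong n (proj₂ (∧-cong (suc n) (I zero) (⋀-zeroFirstColumn n n (I ∘ suc) (λ i → refl)))) ⟩
    top n (1# *ₗ ω +ᴹ -ᴹ (I zero ∘ suc ∧ 0ᴹ))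
      ≈⟨ top-cong n (+ᴹ-cong (*ₗ-identityˡ ω) (≈ᴹ-trans (-ᴹ‿cong (∧-0 n _)) ε⁻¹≈ε)) ⟩
    top n (ω +ᴹ 0ᴹ)
      ≈⟨ top-cong n (+ᴹ-identityʳ ω) ⟩
    top n ω
      ≈⟨ det-identity n ⟩
    1# ∎
    where
    open Λ n
    open SetoidReasoning setoid
    I = identity rawRing {suc n}
    ω = ⋀ (identity rawRing {n})

  -- The determinant trick over an arbitrary module

  module _ {m ℓm} (M : LeftModule ring m ℓm) where
    open LeftModule M
    open LeftModuleProperties R M
    open AbelianGroupProperties +ᴹ-abelianGroup using (ε⁻¹≈ε; ⁻¹-involutive)
    open CommutativeMonoidSum +ᴹ-commutativeMonoid
    open SetoidReasoning ≈ᴹ-setoid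

    -- For fixed ω the map v ↦ top (v ∧ ω) is a linear functional, so it may be applied to Σᵢ cᵢ eᵢ
    -- = 0, which the hypothesis gives coordinate by coordinate. The induction peels off one
    -- coordinate through top (v ∧ (α , β)) = v₀ top α - top (v′ ∧ β).
    relation-∧ : ∀ m n (c : Fin m → Fin n → Carrier) (e : Fin m → Carrierᴹ) →
      (∀ j → sum (λ i → c i j *ₗ e i) ≈ᴹ 0ᴹ) →
      ∀ ω → sum (λ i → top n (c i ∧ ω) *ₗ e i) ≈ᴹ 0ᴹ
    relation-∧ m zero    c e relation ω = begin
      sum (λ i → 0# *ₗ e i)  ≈⟨ sum-cong-≋ (λ i → *ₗ-zeroˡ (e i)) ⟩
      sum {m} (λ i → 0ᴹ)     ≈⟨ sum-replicate-zero m ⟩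
      0ᴹ                     ∎
    relation-∧ m (suc n) c e relation (α , β) = begin
      sum (λ i → top n (Λ._+ᴹ_ n (Λ._*ₗ_ n (c i zero) α) (Λ.-ᴹ_ n (c′ i ∧ β))) *ₗ e i)
        ≈⟨ sum-cong-≋ term ⟩
      sum (λ i → top n α *ₗ (c i zero *ₗ e i) +ᴹ (- 1#) *ₗ (top n (c′ i ∧ β) *ₗ e i))
        ≈⟨ ∑-distrib-+ (λ i → top n α *ₗ (c i zero *ₗ e i)) _ ⟩
      sum (λ i → top n α *ₗ (c i zero *ₗ e i)) +ᴹ sum (λ i → (- 1#) *ₗ (top n (c′ i ∧ β) *ₗ e i))
        ≈⟨ +ᴹ-cong (*ₗ-distribˡ-sum m (top n α) _) (*ₗ-distribˡ-sum m (- 1#) _) ⟨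
      top n α *ₗ sum (λ i → c i zero *ₗ e i) +ᴹ (- 1#) *ₗ sum (λ i → top n (c′ i ∧ β) *ₗ e i)
        ≈⟨ +ᴹ-cong (*ₗ-congˡ (relation zero)) (*ₗ-congˡ (relation-∧ m n c′ e (relation ∘ suc) β)) ⟩
      top n α *ₗ 0ᴹ +ᴹ (- 1#) *ₗ 0ᴹ
        ≈⟨ +ᴹ-cong (*ₗ-zeroʳ _) (*ₗ-zeroʳ _) ⟩
      0ᴹ +ᴹ 0ᴹ
        ≈⟨ +ᴹ-identityˡ 0ᴹ ⟩
      0ᴹ ∎
      where
      c′ : Fin m → Fin n → Carrier
      c′ i = c i ∘ suc
      term : ∀ i → top n (Λ._+ᴹ_ n (Λ._*ₗ_ n (c i zero) α) (Λ.-ᴹ_ n (c′ i ∧ β))) *ₗ e i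
        ≈ᴹ top n α *ₗ (c i zero *ₗ e i) +ᴹ (- 1#) *ₗ (top n (c′ i ∧ β) *ₗ e i)
      term i = begin
        top n (Λ._+ᴹ_ n (Λ._*ₗ_ n (c i zero) α) (Λ.-ᴹ_ n (c′ i ∧ β))) *ₗ e i
          ≈⟨ *ₗ-congʳ (trans (top-+ n _ _) (+-cong (top-scale n _ α) (top-neg n _))) ⟩
        (c i zero * top n α + - top n (c′ i ∧ β)) *ₗ e i
          ≈⟨ *ₗ-distribʳ _ _ _ ⟩
        (c i zero * top n α) *ₗ e i +ᴹ (- top n (c′ i ∧ β)) *ₗ e i
          ≈⟨ +ᴹ-cong (*ₗ-congʳ (*-comm _ _)) (*ₗ-congʳ (sym (-1*x≈-x _))) ⟩
        (top n α * c i zero) *ₗ e i +ᴹ (- 1# * top n (c′ i ∧ β)) *ₗ e i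
          ≈⟨ +ᴹ-cong (*ₗ-assoc _ _ _) (*ₗ-assoc _ _ _) ⟩
        top n α *ₗ (c i zero *ₗ e i) +ᴹ (- 1#) *ₗ (top n (c′ i ∧ β) *ₗ e i) ∎

    -- The determinant trick: wedging the relation Σᵢ cᵢ eᵢ = 0 with all cᵢ except cₖ
    -- leaves only ± det c · eₖ.
    det-annihilates : ∀ m n (c : Fin m → Fin n → Carrier) (e : Fin m → Carrierᴹ) →
      (∀ j → sum (λ i → c i j *ₗ e i) ≈ᴹ 0ᴹ) → ∀ k → det c *ₗ e k ≈ᴹ 0ᴹ
    det-annihilates (suc m) n c e relation k = fromSign (∧-⋀-removeAt m n c k)
      where
      others = ⋀ (c ∘ punchIn k)
      signed : top n (c k ∧ others) *ₗ e k ≈ᴹ 0ᴹ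
      signed = begin
        top n (c k ∧ others) *ₗ e k
          ≈⟨ +ᴹ-identityʳ _ ⟨
        top n (c k ∧ others) *ₗ e k +ᴹ 0ᴹ
          ≈⟨ +ᴹ-congˡ (sum-replicate-zero m) ⟨
        top n (c k ∧ others) *ₗ e k +ᴹ sum {m} (λ l → 0ᴹ)
          ≈⟨ +ᴹ-congˡ (sum-cong-≋ (λ l → ≈ᴹ-trans (*ₗ-congʳ (trans
               (top-cong n (∧-⋀-member m n (c ∘ punchIn k) l)) (top-0 n))) (*ₗ-zeroˡ _))) ⟨
        top n (c k ∧ others) *ₗ e k +ᴹ
          sum (λ l → top n (c (punchIn k l) ∧ others) *ₗ e (punchIn k l))
          ≈⟨ sum-remove {i = k} (λ i → top n (c i ∧ others) *ₗ e i) ⟨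
        sum (λ i → top n (c i ∧ others) *ₗ e i)
          ≈⟨ relation-∧ (suc m) n c e relation others ⟩
        0ᴹ ∎
      fromSign : (Λ._≈ᴹ_ n (c k ∧ others) (⋀ c)) ⊎ (Λ._≈ᴹ_ n (c k ∧ others) (Λ.-ᴹ_ n (⋀ c))) →
        det c *ₗ e k ≈ᴹ 0ᴹ
      fromSign (inj₁ even) = ≈ᴹ-trans (*ₗ-congʳ (sym (top-cong n even))) signed
      fromSign (inj₂ odd)  = begin
        det c *ₗ e k                          ≈⟨ ⁻¹-involutive _ ⟨
        -ᴹ (-ᴹ (det c *ₗ e k))                ≈⟨ -ᴹ‿cong (*ₗ-negˡ _ _) ⟨
        -ᴹ ((- det c) *ₗ e k)                 ≈⟨ -ᴹ‿cong (*ₗ-congʳ (trans (top-cong n odd) (top-neg n (⋀ c)))) ⟨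
        -ᴹ (top n (c k ∧ others) *ₗ e k)      ≈⟨ -ᴹ‿cong signed ⟩
        -ᴹ 0ᴹ                                 ≈⟨ ε⁻¹≈ε ⟩
        0ᴹ                                    ∎

-- Cayley–Hamilton and linear recurrences

module LinearRecurrence {c ℓ} (R : CommutativeRing c ℓ) where
  open CommutativeRing R hiding (zero) renaming (_*_ to _·_)
  open Univariate rawRing
  open PolynomialRing R
  open RingProperties ring using (-‿distribˡ-*; -1*x≈-x)
  open SemiringSum semiring
  open CommutativeSemigroupProperties +-commutativeSemigroup using (interchange)
  open CommutativeSemigroupProperties *-commutativeSemigroup using () renaming (x∙yz≈y∙xz to x·yz≈y·xz)
  open SetoidReasoning setoid

  -- p has degree at most d, and a is its coefficient at Xᵈ.
  Leading : ℕ → Poly → Carrier → Set ℓ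
  Leading d p a = ∀ i → coeff p (d ℕ.+ i) ≈ coeff (const a) i

  Leading-0 : ∀ d → Leading d [] 0#
  Leading-0 d zero    = refl
  Leading-0 d (suc i) = refl

  Leading-+ : ∀ d p q {a b} → Leading d p a → Leading d q b → Leading d (p +ₚ q) (a + b)
  Leading-+ d p q {a} {b} p-lead q-lead i = begin
    coeff (p +ₚ q) (d ℕ.+ i)                  ≈⟨ coeff-+ p q (d ℕ.+ i) ⟩
    coeff p (d ℕ.+ i) + coeff q (d ℕ.+ i)     ≈⟨ +-cong (p-lead i) (q-lead i) ⟩
    coeff (const a) i + coeff (const b) i     ≈⟨ coeff-+ (const a) (const b) i ⟨
    coeff (const (a + b)) i                   ∎

  Leading-neg : ∀ d p {a} → Leading d p a → Leading d (map (-_) p) (- a)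
  Leading-neg d p {a} p-lead i = begin
    coeff (map (-_) p) (d ℕ.+ i)  ≈⟨ coeff-neg p (d ℕ.+ i) ⟩
    - coeff p (d ℕ.+ i)           ≈⟨ -‿cong (p-lead i) ⟩
    - coeff (const a) i           ≈⟨ coeff-neg (const a) i ⟨
    coeff (const (- a)) i         ∎

  coeff-const-* : ∀ b q i → coeff (const b *ₚ q) i ≈ b · coeff q i
  coeff-const-* b q zero    = coeff-*-zero b [] q
  coeff-const-* b q (suc i) = trans (coeff-*-suc b [] q i) (+-identityʳ _)

  -- From degree d + 1 on, the constant term `a` meets only coefficients of `q` beyond d, which
  -- vanish; only `b` contributes.
  Leading-linear-* : ∀ d a b q {e} → Leading d q e →
    Leading (suc d) ((a ∷ b ∷ []) *ₚ q) (b · e)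
  Leading-linear-* d a b q {e} q-lead i = begin
    coeff ((a ∷ b ∷ []) *ₚ q) (suc d ℕ.+ i)
      ≈⟨ coeff-*-suc a (const b) q (d ℕ.+ i) ⟩
    a · coeff q (suc (d ℕ.+ i)) + coeff (const b *ₚ q) (d ℕ.+ i)
      ≈⟨ +-cong (*-congˡ (reflexive (≡.cong (coeff q) (≡.sym (ℕ.+-suc d i)))))
                (coeff-const-* b q (d ℕ.+ i)) ⟩
    a · coeff q (d ℕ.+ suc i) + b · coeff q (d ℕ.+ i)
      ≈⟨ +-cong (trans (*-congˡ (q-lead (suc i))) (zeroʳ a)) (*-congˡ (q-lead i)) ⟩
    0# + b · coeff (const e) i
      ≈⟨ +-identityˡ _ ⟩
    b · coeff (const e) i
      ≈⟨ coeff-scale b (const e) i ⟨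
    coeff (const (b · e)) i ∎

  -- Leading coefficients of determinants with linear entries

  private
    module E = ExteriorAlgebra R
    module Eₚ = ExteriorAlgebra polyCommutativeRing

  -- Pairs a form over R[X] with the form over R made of its coefficients at Xᵈ. An exterior product
  -- of linear rows is thereby shadowed by the exterior product of their X-coefficients, and no
  -- determinant has to be expanded.
  LeadingΛ : ∀ n → ℕ → Eₚ.∣Λ∣ n → E.∣Λ∣ n → Set ℓ
  LeadingΛ zero    d ω       η       = Leading d ω η
  LeadingΛ (suc n) d (α , β) (γ , δ) = LeadingΛ n d α γ × LeadingΛ n d β δ

  LeadingΛ-0 : ∀ n d → LeadingΛ n d (Eₚ.Λ.0ᴹ n) (E.Λ.0ᴹ n)
  LeadingΛ-0 zero    d = Leading-0 d
  LeadingΛ-0 (suc n) d = LeadingΛ-0 n d , LeadingΛ-0 n d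

  LeadingΛ-sub : ∀ n d ω₁ ω₂ {η₁ η₂} → LeadingΛ n d ω₁ η₁ → LeadingΛ n d ω₂ η₂ →
    LeadingΛ n d (Eₚ.Λ._+ᴹ_ n ω₁ (Eₚ.Λ.-ᴹ_ n ω₂)) (E.Λ._+ᴹ_ n η₁ (E.Λ.-ᴹ_ n η₂))
  LeadingΛ-sub zero    d ω₁        ω₂        l₁        l₂        =
    Leading-+ d ω₁ _ l₁ (Leading-neg d ω₂ l₂)
  LeadingΛ-sub (suc n) d (α₁ , β₁) (α₂ , β₂) (k₁ , l₁) (k₂ , l₂) =
    LeadingΛ-sub n d α₁ α₂ k₁ k₂ , LeadingΛ-sub n d β₁ β₂ l₁ l₂

  LeadingΛ-linear-*ₗ : ∀ n d a b ω {η} → LeadingΛ n d ω η →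
    LeadingΛ n (suc d) (Eₚ.Λ._*ₗ_ n (a ∷ b ∷ []) ω) (E.Λ._*ₗ_ n b η)
  LeadingΛ-linear-*ₗ zero    d a b ω       l       = Leading-linear-* d a b ω l
  LeadingΛ-linear-*ₗ (suc n) d a b (α , β) (k , l) =
    LeadingΛ-linear-*ₗ n d a b α k , LeadingΛ-linear-*ₗ n d a b β l

  LeadingΛ-∧ : ∀ n d (a b : Fin n → Carrier) ω {η} → LeadingΛ n d ω η →
    LeadingΛ n (suc d) (Eₚ._∧_ (λ j → a j ∷ b j ∷ []) ω) (E._∧_ b η)
  LeadingΛ-∧ zero    d a b ω       l       = Leading-0 (suc d)
  LeadingΛ-∧ (suc n) d a b (α , β) (k , l) =
    LeadingΛ-∧ n d (a ∘ suc) (b ∘ suc) α k ,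
    LeadingΛ-sub n (suc d) _ _ (LeadingΛ-linear-*ₗ n d (a zero) (b zero) α k)
      (LeadingΛ-∧ n d (a ∘ suc) (b ∘ suc) β l)

  LeadingΛ-unit : ∀ n → LeadingΛ n 0 (Eₚ.unit n) (E.unit n)
  LeadingΛ-unit zero    = λ i → refl
  LeadingΛ-unit (suc n) = LeadingΛ-unit n , LeadingΛ-0 n 0

  -- Each row raises the degree bound by one. Together with `Leading-top` this says that det (a + X
  -- b) has coefficient det b at Xᵐ; for the characteristic matrix b is the identity.
  LeadingΛ-⋀ : ∀ m n (a b : Fin m → Fin n → Carrier) →
    LeadingΛ n m (Eₚ.⋀ (λ i j → a i j ∷ b i j ∷ [])) (E.⋀ b)
  LeadingΛ-⋀ zero    n a b = LeadingΛ-unit n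
  LeadingΛ-⋀ (suc m) n a b =
    LeadingΛ-∧ n m (a zero) (b zero) _ (LeadingΛ-⋀ m n (a ∘ suc) (b ∘ suc))

  Leading-top : ∀ n d ω {η} → LeadingΛ n d ω η → Leading d (Eₚ.top n ω) (E.top n η)
  Leading-top zero    d ω       l       = l
  Leading-top (suc n) d (α , β) (k , l) = Leading-top n d β l

  -- X acts on sequences as the shift: act p u m = Σₖ pₖ uₘ₊ₖ.
  act : Poly → (ℕ → Carrier) → ℕ → Carrier
  act []      u m = 0#
  act (a ∷ p) u m = a · u m + act p u (suc m)

  act-shift : ∀ p u m → act p (u ∘ suc) m ≈ act p u (suc m)
  act-shift []      u m = refl
  act-shift (a ∷ p) u m = +-congˡ (act-shift p u (suc m))

  act-congʳ : ∀ p {u v} → (∀ m → u m ≈ v m) → ∀ m → act p u m ≈ act p v m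
  act-congʳ []      u≈v m = refl
  act-congʳ (a ∷ p) u≈v m = +-cong (*-congˡ (u≈v m)) (act-congʳ p u≈v (suc m))

  -- Needed for `act` to respect `_≈ₚ_`: equal polynomials may be lists of different lengths, and
  -- the surplus zeros must act as zero.
  act-≈0 : ∀ p u → p ≈ₚ [] → ∀ m → act p u m ≈ 0#
  act-≈0 []      u p≈0 m = refl
  act-≈0 (a ∷ p) u p≈0 m = begin
    a · u m + act p u (suc m)  ≈⟨ +-cong (*-congʳ (p≈0 0)) (act-≈0 p u (p≈0 ∘ suc) (suc m)) ⟩
    0# · u m + 0#              ≈⟨ +-identityʳ _ ⟩
    0# · u m                   ≈⟨ zeroˡ _ ⟩
    0#                         ∎

  act-congˡ : ∀ p q u → p ≈ₚ q → ∀ m → act p u m ≈ act q u m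
  act-congˡ []      q       u p≈q m = sym (act-≈0 q u (λ i → sym (p≈q i)) m)
  act-congˡ (a ∷ p) []      u p≈q m = act-≈0 (a ∷ p) u p≈q m
  act-congˡ (a ∷ p) (b ∷ q) u p≈q m =
    +-cong (*-congʳ (p≈q 0)) (act-congˡ p q u (p≈q ∘ suc) (suc m))

  act-+ₚ : ∀ p q u m → act (p +ₚ q) u m ≈ act p u m + act q u m
  act-+ₚ []      q       u m = sym (+-identityˡ _)
  act-+ₚ (a ∷ p) []      u m = sym (+-identityʳ _)
  act-+ₚ (a ∷ p) (b ∷ q) u m =
    trans (+-cong (distribʳ _ _ _) (act-+ₚ p q u (suc m))) (interchange _ _ _ _)

  act-scale : ∀ a p u m → act (map (a ·_) p) u m ≈ a · act p u m
  act-scale a []      u m = sym (zeroʳ a)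
  act-scale a (b ∷ p) u m =
    trans (+-cong (*-assoc _ _ _) (act-scale a p u (suc m))) (sym (distribˡ _ _ _))

  act-*ₚ : ∀ p q u m → act (p *ₚ q) u m ≈ act p (act q u) m
  act-*ₚ []      q u m = refl
  act-*ₚ (a ∷ p) q u m = begin
    act (map (a ·_) q +ₚ (0# ∷ (p *ₚ q))) u m
      ≈⟨ act-+ₚ (map (a ·_) q) _ u m ⟩
    act (map (a ·_) q) u m + (0# · u m + act (p *ₚ q) u (suc m))
      ≈⟨ +-cong (act-scale a q u m)
                (trans (+-congʳ (zeroˡ _)) (trans (+-identityˡ _) (act-*ₚ p q u (suc m)))) ⟩
    a · act q u m + act p (act q u) (suc m) ∎

  act-+ : ∀ p u v m → act p (λ m → u m + v m) m ≈ act p u m + act p v m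
  act-+ []      u v m = sym (+-identityˡ 0#)
  act-+ (a ∷ p) u v m =
    trans (+-cong (distribˡ _ _ _) (act-+ p u v (suc m))) (interchange _ _ _ _)

  act-· : ∀ p r u m → act p (λ m → r · u m) m ≈ r · act p u m
  act-· []      r u m = sym (zeroʳ r)
  act-· (a ∷ p) r u m =
    trans (+-cong (x·yz≈y·xz _ _ _) (act-· p r u (suc m))) (sym (distribˡ _ _ _))

  act-0 : ∀ p m → act p (λ _ → 0#) m ≈ 0#
  act-0 []      m = refl
  act-0 (a ∷ p) m = trans (+-cong (zeroʳ a) (act-0 p (suc m))) (+-identityʳ 0#)

  act-sum : ∀ k p (u : Fin k → ℕ → Carrier) m →
    act p (λ m → sum (λ s → u s m)) m ≈ sum (λ s → act p (u s) m)
  act-sum zero    p u m = act-0 p m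
  act-sum (suc k) p u m = trans (act-+ p (u zero) _ m) (+-congˡ (act-sum k p (u ∘ suc) m))

  sequenceModule : LeftModule (CommutativeRing.ring polyCommutativeRing) c ℓ
  sequenceModule = record
    { Carrierᴹ = ℕ → Carrier
    ; _≈ᴹ_     = λ u v → ∀ m → u m ≈ v m
    ; _+ᴹ_     = λ u v m → u m + v m
    ; _*ₗ_     = act
    ; 0ᴹ       = λ m → 0#
    ; -ᴹ_      = λ u m → - u m
    ; isLeftModule = record
      { isLeftSemimodule = record
        { +ᴹ-isCommutativeMonoid = record
          { isMonoid = record
            { isSemigroup = record
              { isMagma = record
                { isEquivalence = record
                  { refl  = λ m → refl
                  ; sym   = λ u≈v m → sym (u≈v m)
                  ; trans = λ u≈v v≈w m → trans (u≈v m) (v≈w m)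
                  }
                ; ∙-cong = λ u≈v w≈x m → +-cong (u≈v m) (w≈x m)
                }
              ; assoc = λ u v w m → +-assoc _ _ _
              }
            ; identity = (λ u m → +-identityˡ _) , (λ u m → +-identityʳ _)
            }
          ; comm = λ u v m → +-comm _ _
          }
        ; isPreleftSemimodule = record
          { *ₗ-cong      = λ {p} {q} {u} {v} p≈q u≈v m →
              trans (act-congˡ p q u p≈q m) (act-congʳ q u≈v m)
          ; *ₗ-zeroˡ     = λ u m → refl
          ; *ₗ-distribʳ  = λ u p q m → act-+ₚ p q u m
          ; *ₗ-identityˡ = λ u m → trans (+-identityʳ _) (*-identityˡ _)
          ; *ₗ-assoc     = λ p q u m → act-*ₚ p q u m
          ; *ₗ-zeroʳ     = λ p m → act-0 p m
          ; *ₗ-distribˡ  = act-+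
          }
        }
      ; -ᴹ‿cong    = λ u≈v m → -‿cong (u≈v m)
      ; -ᴹ‿inverse = (λ u m → -‿inverseˡ _) , (λ u m → -‿inverseʳ _)
      }
    }

  open CommutativeMonoidSum (LeftModule.+ᴹ-commutativeMonoid sequenceModule)
    using () renaming (sum to sumᴹ)

  sumᴹ-apply : ∀ k (u : Fin k → ℕ → Carrier) m → sumᴹ u m ≡ sum (λ s → u s m)
  sumᴹ-apply zero    u m = ≡.refl
  sumᴹ-apply (suc k) u m = ≡.cong (u zero m +_) (sumᴹ-apply k (u ∘ suc) m)

  sum-identity : ∀ n (f : Fin n → Carrier) i → sum (λ k → identity rawRing k i · f k) ≈ f i
  sum-identity (suc n) f zero    = begin
    1# · f zero + sum (λ k → 0# · f (suc k))
      ≈⟨ +-cong (*-identityˡ _) (sum-cong-≋ {n} (λ k → zeroˡ (f (suc k)))) ⟩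
    f zero + sum {n} (λ k → 0#)
      ≈⟨ trans (+-congˡ (sum-replicate-zero n)) (+-identityʳ _) ⟩
    f zero ∎
  sum-identity (suc n) f (suc i) =
    trans (+-cong (zeroˡ _) (sum-identity n (f ∘ suc) i)) (+-identityˡ _)

  -- Cayley-Hamilton for the sequences of entries

  module _ {n} (A : Matrix rawRing n) where
    -- XI - Aᵀ: transposed so that the rows, not the columns, carry the relations.
    characteristicMatrix : Fin n → Fin n → Poly
    characteristicMatrix k i = - A i k ∷ identity rawRing k i ∷ []

    charPoly : Poly
    charPoly = Eₚ.det characteristicMatrix

    charPoly-monic : Leading n charPoly 1#
    charPoly-monic i = begin
      coeff charPoly (n ℕ.+ i)
        ≈⟨ Leading-top n n _ (LeadingΛ-⋀ n n (λ k i → - A i k) (identity rawRing)) i ⟩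
      coeff (const (E.det (identity rawRing {n}))) i
        ≈⟨ constCong i ⟩
      coeff (const 1#) i ∎
      where
      constCong : const (E.det (identity rawRing {n})) ≈ₚ const 1#
      constCong zero    = E.det-identity n
      constCong (suc i) = refl

    entrySequence : Fin n → Fin n → ℕ → Carrier
    entrySequence i j m = power rawRing A m i j

    -- This is Aᵐ⁺¹ = A Aᵐ read in column j: Σₖ `A i k · u k m` is `u i (suc m)` by the definition
    -- of `power`, and the identity part of the matrix picks out the same term with the opposite
    -- sign.
    shiftRelation : ∀ j i m →
      sumᴹ (λ k → act (characteristicMatrix k i) (entrySequence k j)) m ≈ 0#
    shiftRelation j i m = begin
      sumᴹ (λ k → act (characteristicMatrix k i) (entrySequence k j)) m
        ≡⟨ sumᴹ-apply n (λ k → act (characteristicMatrix k i) (entrySequence k j)) m ⟩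
      sum (λ k → - A i k · u k m + (identity rawRing k i · u k (suc m) + 0#))
        ≈⟨ sum-cong-≋ {n} (λ k → +-cong
             (trans (sym (-‿distribˡ-* (A i k) (u k m))) (sym (-1*x≈-x _))) (+-identityʳ _)) ⟩
      sum (λ k → - 1# · (A i k · u k m) + identity rawRing k i · u k (suc m))
        ≈⟨ ∑-distrib-+ (λ k → - 1# · (A i k · u k m)) _ ⟩
      sum (λ k → - 1# · (A i k · u k m)) + sum (λ k → identity rawRing k i · u k (suc m))
        ≈⟨ +-cong (trans (sym (*-distribˡ-sum (- 1#) (λ k → A i k · u k m))) (-1*x≈-x _))
                  (sum-identity n (λ k → u k (suc m)) i) ⟩
      - u i (suc m) + u i (suc m)
        ≈⟨ -‿inverseˡ _ ⟩
      0# ∎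
      where
      u : Fin n → ℕ → Carrier
      u k = entrySequence k j

    -- The left side is the (i , j) entry of χ(A) Aᵐ. Column j stays fixed while its n entry
    -- sequences play the part of the module elements tied by the relations.
    cayleyHamilton : ∀ i j m → act charPoly (entrySequence i j) m ≈ 0#
    cayleyHamilton i j = Eₚ.det-annihilates sequenceModule n n characteristicMatrix
      (λ k → entrySequence k j) (shiftRelation j) i

  -- Monic recurrences

  act-leading : ∀ d p a u → Leading d p a → (∀ i → i < d → u i ≈ 0#) → act p u 0 ≈ a · u d
  act-leading zero    p       a u lead vanish =
    trans (act-congˡ p (const a) u lead 0) (+-identityʳ _)
  -- The empty list has no coefficient at X to the d + 1, so `lead 0` forces `a` to vanish.
  act-leading (suc d) []      a u lead vanish =
    sym (trans (*-congʳ (sym (lead 0))) (zeroˡ _))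
  act-leading (suc d) (b ∷ p) a u lead vanish = begin
    b · u 0 + act p u 1       ≈⟨ +-congʳ (trans (*-congˡ (vanish 0 (s≤s z≤n))) (zeroʳ b)) ⟩
    0# + act p u 1            ≈⟨ +-identityˡ _ ⟩
    act p u 1                 ≈⟨ act-shift p u 0 ⟨
    act p (u ∘ suc) 0         ≈⟨ act-leading d p a (u ∘ suc) lead (λ i i<d → vanish (suc i) (s≤s i<d)) ⟩
    a · u (suc d)             ∎

  -- After d zeros the recurrence at 0 reduces to its leading term, and the coefficient 1# makes
  -- `u d` vanish as well. The shifted sequence then also starts with d zeros and obeys the same
  -- recurrence, so the induction on m slides the window.
  recurrence-vanishes : ∀ d p u → Leading d p 1# → (∀ m → act p u m ≈ 0#) →
    (∀ i → i < d → u i ≈ 0#) → ∀ m → u m ≈ 0#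
  recurrence-vanishes d p u monic pu≈0 vanish = vanishes
    where
    vanish≤ : ∀ i → i ℕ.≤ d → u i ≈ 0#
    vanish≤ i i≤d with ℕ.m≤n⇒m<n∨m≡n i≤d
    ... | inj₁ i<d    = vanish i i<d
    ... | inj₂ ≡.refl = begin
      u d       ≈⟨ *-identityˡ _ ⟨
      1# · u d  ≈⟨ act-leading d p 1# u monic vanish ⟨
      act p u 0 ≈⟨ pu≈0 0 ⟩
      0#        ∎
    vanishes : ∀ m → u m ≈ 0#
    vanishes zero    = vanish≤ 0 z≤n
    vanishes (suc m) = recurrence-vanishes d p (u ∘ suc) monic
      (λ m → trans (act-shift p u m) (pu≈0 (suc m))) (λ i i<d → vanish≤ (suc i) i<d) m

-- Linear dependence among the entries of powers

open import Data.Nat.Base using (_*_)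

module _ {c ℓ} {R : RawRing c ℓ} (domain : IsDiscreteDomain R) where
  open IsDiscreteDomain domain using (commutativeRing)
  open CommutativeRing commutativeRing hiding (zero) renaming (_*_ to _·_)
  open Underdetermined domain
  open LinearRecurrence commutativeRing
  open SemiringSum semiring using (sum; sum-cong-≋; sum-replicate-zero)
  open SetoidReasoning setoid

  act-if : ∀ p b r u m →
    act p (λ m → if b then r · u m else 0#) m ≈ (if b then r · act p u m else 0#)
  act-if p true  r u m = act-· p r u m
  act-if p false r u m = act-0 p m

  if-zero : ∀ b {x} → x ≈ 0# → (if b then x else 0#) ≈ 0#
  if-zero true  x≈0 = x≈0
  if-zero false x≈0 = refl

  act-sumOver : ∀ {k} (S : Subset k) p (q : Fin k → Carrier) (u : Fin k → ℕ → Carrier) →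
    (∀ s m → act p (u s) m ≈ 0#) → ∀ m → act p (λ m → sumOver R S (λ s → q s · u s m)) m ≈ 0#
  act-sumOver {k} S p q u pu≈0 m = begin
    act p (λ m → sumOver R S (λ s → q s · u s m)) m
      ≈⟨ act-sum k p (λ s m → if does (s ∈? S) then q s · u s m else 0#) m ⟩
    sum (λ s → act p (λ m → if does (s ∈? S) then q s · u s m else 0#) m)
      ≈⟨ sum-cong-≋ (λ s → trans (act-if p (does (s ∈? S)) (q s) (u s) m)
           (if-zero (does (s ∈? S)) (trans (*-congˡ (pu≈0 s m)) (zeroʳ (q s))))) ⟩
    sum {k} (λ s → 0#)
      ≈⟨ sum-replicate-zero k ⟩
    0# ∎

  entriesOfPowersDependent : ∀ n (A : Matrix R n) (S : Subset (n * n)) → ∣ S ∣ ≡ suc n →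
    Σ (Position n → Carrier) λ q →
      (∃ λ s → s ∈ S × ¬ (q s ≈ 0#)) ×
      (∀ m → m > 1 → sumOver R S (λ s → q s · entry R (power R A m) s) ≈ 0#)
  entriesOfPowersDependent n A S ∣S∣≡1+n = q , proj₁ (proj₂ solution) , dependent
    where
    -- The offset 2 is the least exponent with `m > 1`; equation i asks for vanishing at exponent 2
    -- + i.
    solution = underdeterminedOver n S ∣S∣≡1+n (λ i → entry R (power R A (2 ℕ.+ toℕ i)))
    q = proj₁ solution
    w : ℕ → Carrier
    w t = sumOver R S (λ s → q s · entry R (power R A (2 ℕ.+ t)) s)
    -- The action of a polynomial commutes with the shift, so the entry sequences started at
    -- exponent 2 keep the recurrence, and their fixed linear combination `w` inherits it.
    w-recurrence : ∀ t → act (charPoly A) w t ≈ 0#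
    w-recurrence = act-sumOver S (charPoly A) q (λ s t → entry R (power R A (2 ℕ.+ t)) s) λ s t →
      let i = proj₁ (remQuot n s); j = proj₂ (remQuot {n} n s); u = entrySequence A i j in begin
      act (charPoly A) (λ t → u (2 ℕ.+ t)) t   ≈⟨ act-shift (charPoly A) (λ t → u (suc t)) t ⟩
      act (charPoly A) (λ t → u (suc t)) (suc t)   ≈⟨ act-shift (charPoly A) u (suc t) ⟩
      act (charPoly A) u (suc (suc t))     ≈⟨ cayleyHamilton A i j (suc (suc t)) ⟩
      0#                                   ∎
    w-initial : ∀ i → i < n → w i ≈ 0#
    w-initial i i<n = ≡.subst (λ t → w t ≈ 0#) (toℕ-fromℕ< i<n) (proj₂ (proj₂ solution) (fromℕ< i<n))
    dependent : ∀ m → m > 1 → sumOver R S (λ s → q s · entry R (power R A m) s) ≈ 0#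
    dependent (suc (suc t)) (s≤s (s≤s z≤n)) =
      recurrence-vanishes n (charPoly A) w (charPoly-monic A) w-recurrence w-initial t

mainTheorem1 : (n : ℕ) → n ≥ 1 →
    (S : Subset (n * n)) → ∣ S ∣ ≡ suc n →
    let open RawRing ℚ[ n * n ] renaming (_*_ to _·_) in
    Σ (Position n → Carrier) λ q →
    (∃ λ s → s ∈ S × ¬ (q s ≈ 0#)) ×
    (∀ (m : ℕ) → m > 1 →
    sumOver ℚ[ n * n ] S
    (λ s → q s · entry ℚ[ n * n ] (power ℚ[ n * n ] (generalMatrix n) m) s) ≈ 0#)
mainTheorem1 n n≥1 = entriesOfPowersDependent ℚ[ n * n ]-isDiscreteDomain n (generalMatrix n)
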